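{- For every $n\geq 0$, the transitive tournament $T_n$ is both diagonal and regularly diagonal, i.e. $\mathrm{MH}_{k,\ell}(T_n)=0$ and $\mathrm{EMH}_{k,\ell}(T_n)=0$ for all $k\ne\ell$.
   Context: $R$ is a fixed commutative unital ring. The transitive tournament $T_n$ is the directed graph on vertices $\{0,\dots,n\}$ with a directed edge $i\to j$ if and only if $i<j$. For a directed graph $G$, $d_G(x,y)$ is the minimal length of a directed path from $x$ to $y$ ($\infty$ if none), and $\mathrm{len}(x_0,\dots,x_k)=\sum_{i=0}^{k-1}d_G(x_i,x_{i+1})$ when all terms are finite. $\mathrm{MC}_{k,\ell}(G)$ is the free $R$-module on tuples $(x_0,\dots,x_k)$ of vertices with $x_i\neq x_{i+1}$ and $d_G(x_i,x_{i+1})<\infty$ for all $i$ and length $\ell$; $\mathrm{EMC}_{k,\ell}(G)$ is the submodule spanned by those tuples whose entries are pairwise distinct. The differential on both is $\partial=\sum_{i=1}^{k-1}(-1)^i\partial_i$, where $\partial_i$ deletes $x_i$ if the resulting tuple still has length $\ell$ and is $0$ otherwise. $\mathrm{MH}_{k,\ell}(G)=H_k(\mathrm{MC}_{*,\ell}(G))$ and $\mathrm{EMH}_{k,\ell}(G)=H_k(\mathrm{EMC}_{*,\ell}(G))$. -}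

module Defs where

open import Algebra.Bundles using (CommutativeRing; CommutativeMonoid)
open import Algebra.Module.Bundles using (Module)
open import Algebra.Module.Morphism.Structures using (IsModuleHomomorphism)
open import Algebra.Module.Structures.Biased using (IsModuleFromLeft)
import Algebra.Module.Properties as ModuleProperties
import Algebra.Properties.AbelianGroup as AbelianGroupProperties
import Algebra.Properties.CommutativeSemigroup as CommutativeSemigroupProperties
import Algebra.Properties.Monoid.Sum as MonoidSum
import Algebra.Properties.Semiring.Exp as SemiringExp
open import Data.Fin as Fin using (Fin; zero; suc; inject₁; toℕ)
import Data.Fin.Properties as Fin
open import Data.Nat using (ℕ; zero; suc; _+_; _∸_; _≤_; _<_; z≤n; s≤s)
import Data.Nat.Properties as ℕ
open import Data.Product using (∃; _×_; _,_)
open import Data.Unit.Polymorphic using (⊤)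
open import Data.Vec using (Vec; []; _∷_; removeAt)
open import Data.Vec.Relation.Unary.Linked using (Linked; _∷_)
open import Data.Vec.Relation.Unary.Unique.Propositional using (Unique)
open import Function using (flip)
open import Level using (Level; _⊔_; 0ℓ) renaming (suc to lsuc)
open import Relation.Binary using (Rel; Setoid; Decidable)
open import Relation.Binary.PropositionalEquality
  using (_≡_; _≢_; refl; sym; trans; cong; cong₂; subst)
import Relation.Binary.Reasoning.Setoid as SetoidReasoning
open import Relation.Nullary using (Dec; yes; no; ¬_)
open import Relation.Nullary.Decidable using (map′; _×-dec_; ¬?)

module _ {r s : Level} (R : CommutativeRing r s) where
  open CommutativeRing R
    using (-_; 0#; 1#; -‿inverseˡ)
    renaming (Carrier to A; _+_ to _⊕_; _*_ to _⊗_; _≈_ to _≋_; refl to ≋-refl)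

  record LinearMap {m n p q : Level} (M : Module R m p) (N : Module R n q)
      : Set (r ⊔ m ⊔ n ⊔ p ⊔ q) where
    private
      module M = Module M
      module N = Module N
    field
      ⟦_⟧ : M.Carrierᴹ → N.Carrierᴹ
      isModuleHomomorphism : IsModuleHomomorphism M.rawModule N.rawModule ⟦_⟧
    open IsModuleHomomorphism isModuleHomomorphism public

  IsZero : {m p : Level} → Module R m p → Set (m ⊔ p)
  IsZero M = ∀ x → x ≈ᴹ 0ᴹ
    where open Module M

  record Submodule {m p : Level} (M : Module R m p) (q : Level) : Set (r ⊔ m ⊔ p ⊔ lsuc q) where
    open Module M
    field
      Member   : Carrierᴹ → Set q
      respects : ∀ {x y} → x ≈ᴹ y → Member x → Member y
      0-closed : Member 0ᴹ
      +-closed : ∀ {x y} → Member x → Member y → Member (x +ᴹ y)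
      *-closed : ∀ a {x} → Member x → Member (a *ₗ x)

  private
    module Negation {m p : Level} (M : Module R m p) where
      open Module M
      open ModuleProperties M using (inverseʳ-uniqueᴹ)

      -1*-inverseʳ : ∀ x → x +ᴹ (- 1#) *ₗ x ≈ᴹ 0ᴹ
      -1*-inverseʳ x = begin
        x +ᴹ (- 1#) *ₗ x        ≈⟨ +ᴹ-comm x _ ⟩
        (- 1#) *ₗ x +ᴹ x        ≈⟨ +ᴹ-congˡ (*ₗ-identityˡ x) ⟨
        (- 1#) *ₗ x +ᴹ 1# *ₗ x  ≈⟨ *ₗ-distribʳ x (- 1#) 1# ⟨
        ((- 1#) ⊕ 1#) *ₗ x      ≈⟨ *ₗ-congʳ (-‿inverseˡ 1#) ⟩
        0# *ₗ x                 ≈⟨ *ₗ-zeroˡ x ⟩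
        0ᴹ                      ∎
        where open SetoidReasoning ≈ᴹ-setoid

      -1*x≈-x : ∀ x → (- 1#) *ₗ x ≈ᴹ -ᴹ x
      -1*x≈-x x = inverseʳ-uniqueᴹ x _ (-1*-inverseʳ x)

  module _ {m p : Level} {M : Module R m p} where
    open Module M

    -‿closed : {q : Level} (S : Submodule M q) → ∀ {x} →
               Submodule.Member S x → Submodule.Member S (-ᴹ x)
    -‿closed S x∈S = respects (Negation.-1*x≈-x M _) (*-closed (- 1#) x∈S)
      where open Submodule S

    infixr 7 _∩_

    _∩_ : {q₁ q₂ : Level} → Submodule M q₁ → Submodule M q₂ → Submodule M (q₁ ⊔ q₂)
    S ∩ T = record
      { Member   = λ x → S.Member x × T.Member x
      ; respects = λ x≈y (x∈S , x∈T) → S.respects x≈y x∈S , T.respects x≈y x∈T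
      ; 0-closed = S.0-closed , T.0-closed
      ; +-closed = λ (x∈S , x∈T) (y∈S , y∈T) → S.+-closed x∈S y∈S , T.+-closed x∈T y∈T
      ; *-closed = λ a (x∈S , x∈T) → S.*-closed a x∈S , T.*-closed a x∈T
      }
      where
      module S = Submodule S
      module T = Submodule T

    data InSpan {q : Level} (P : Carrierᴹ → Set q) : Carrierᴹ → Set (r ⊔ m ⊔ p ⊔ q) where
      generator : ∀ {x} → P x → InSpan P x
      respects  : ∀ {x y} → x ≈ᴹ y → InSpan P x → InSpan P y
      0-closed  : InSpan P 0ᴹ
      +-closed  : ∀ {x y} → InSpan P x → InSpan P y → InSpan P (x +ᴹ y)
      *-closed  : ∀ a {x} → InSpan P x → InSpan P (a *ₗ x)

    span : {q : Level} → (Carrierᴹ → Set q) → Submodule M (r ⊔ m ⊔ p ⊔ q)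
    span P = record
      { Member = InSpan P ; respects = respects ; 0-closed = 0-closed
      ; +-closed = +-closed ; *-closed = *-closed }

    whole : {q : Level} → Submodule M q
    whole = record { Member = λ _ → ⊤ }

    -- The quotient of Z by Z ∩ B; B is not required to lie in Z.
    subquotient : {q₁ q₂ : Level} → Submodule M q₁ → Submodule M q₂ → Module R (m ⊔ q₁) q₂
    subquotient Z B = record
      { Carrierᴹ = ∃ Z.Member
      ; _≈ᴹ_     = λ (x , _) (y , _) → x ∼ y
      ; _+ᴹ_     = λ (x , x∈Z) (y , y∈Z) → x +ᴹ y , Z.+-closed x∈Z y∈Z
      ; _*ₗ_     = λ a (x , x∈Z) → a *ₗ x , Z.*-closed a x∈Z
      ; _*ᵣ_     = λ (x , x∈Z) a → a *ₗ x , Z.*-closed a x∈Z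
      ; 0ᴹ       = 0ᴹ , Z.0-closed
      ; -ᴹ_      = λ (x , x∈Z) → -ᴹ x , -‿closed Z x∈Z
      ; isModule = IsModuleFromLeft.isModule {commutativeRing = R} record
        { isLeftModule = record
          { isLeftSemimodule = record
            { +ᴹ-isCommutativeMonoid = record
              { isMonoid = record
                { isSemigroup = record
                  { isMagma = record
                    { isEquivalence = record
                      { refl = ≈⇒∼ ≈ᴹ-refl ; sym = ∼-sym ; trans = ∼-trans }
                    ; ∙-cong = ∼-+-cong
                    }
                  ; assoc = λ (x , _) (y , _) (z , _) → ≈⇒∼ (+ᴹ-assoc x y z)
                  }
                ; identity = (λ (x , _) → ≈⇒∼ (+ᴹ-identityˡ x))
                           , (λ (x , _) → ≈⇒∼ (+ᴹ-identityʳ x))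
                }
              ; comm = λ (x , _) (y , _) → ≈⇒∼ (+ᴹ-comm x y)
              }
            ; isPreleftSemimodule = record
              { *ₗ-cong      = ∼-*-cong
              ; *ₗ-zeroˡ     = λ (x , _) → ≈⇒∼ (*ₗ-zeroˡ x)
              ; *ₗ-distribʳ  = λ (x , _) a b → ≈⇒∼ (*ₗ-distribʳ x a b)
              ; *ₗ-identityˡ = λ (x , _) → ≈⇒∼ (*ₗ-identityˡ x)
              ; *ₗ-assoc     = λ a b (x , _) → ≈⇒∼ (*ₗ-assoc a b x)
              ; *ₗ-zeroʳ     = λ a → ≈⇒∼ (*ₗ-zeroʳ a)
              ; *ₗ-distribˡ  = λ a (x , _) (y , _) → ≈⇒∼ (*ₗ-distribˡ a x y)
              }
            }
          ; -ᴹ‿cong    = ∼-neg-cong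
          ; -ᴹ‿inverse = (λ (x , _) → ≈⇒∼ (-ᴹ‿inverseˡ x))
                       , (λ (x , _) → ≈⇒∼ (-ᴹ‿inverseʳ x))
          }
        }
      }
      where
      module Z = Submodule Z
      module B = Submodule B
      open AbelianGroupProperties +ᴹ-abelianGroup
        using (x≈y⇒x∙y⁻¹≈ε; ⁻¹-anti-homo‿-; ⁻¹-∙-comm; //-rightDividesˡ)
      open CommutativeSemigroupProperties
        (CommutativeMonoid.commutativeSemigroup +ᴹ-commutativeMonoid) using (interchange)
      open SetoidReasoning ≈ᴹ-setoid

      _∼_ : Rel Carrierᴹ _
      x ∼ y = B.Member (x +ᴹ -ᴹ y)

      ≈⇒∼ : ∀ {x y} → x ≈ᴹ y → x ∼ y
      ≈⇒∼ x≈y = B.respects (≈ᴹ-sym (x≈y⇒x∙y⁻¹≈ε x≈y)) B.0-closed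

      ∼-sym : ∀ {x y} → x ∼ y → y ∼ x
      ∼-sym {x} {y} x∼y = B.respects (⁻¹-anti-homo‿- x y) (-‿closed B x∼y)

      ∼-trans : ∀ {x y z} → x ∼ y → y ∼ z → x ∼ z
      ∼-trans {x} {y} {z} x∼y y∼z = B.respects eq (B.+-closed x∼y y∼z)
        where
        eq : (x +ᴹ -ᴹ y) +ᴹ (y +ᴹ -ᴹ z) ≈ᴹ x +ᴹ -ᴹ z
        eq = begin
          (x +ᴹ -ᴹ y) +ᴹ (y +ᴹ -ᴹ z)  ≈⟨ +ᴹ-assoc _ y (-ᴹ z) ⟨
          ((x +ᴹ -ᴹ y) +ᴹ y) +ᴹ -ᴹ z  ≈⟨ +ᴹ-congʳ (//-rightDividesˡ y x) ⟩
          x +ᴹ -ᴹ z                   ∎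

      ∼-+-cong : ∀ {x y u v} → x ∼ y → u ∼ v → (x +ᴹ u) ∼ (y +ᴹ v)
      ∼-+-cong {x} {y} {u} {v} x∼y u∼v = B.respects eq (B.+-closed x∼y u∼v)
        where
        eq : (x +ᴹ -ᴹ y) +ᴹ (u +ᴹ -ᴹ v) ≈ᴹ (x +ᴹ u) +ᴹ -ᴹ (y +ᴹ v)
        eq = begin
          (x +ᴹ -ᴹ y) +ᴹ (u +ᴹ -ᴹ v)  ≈⟨ interchange x (-ᴹ y) u (-ᴹ v) ⟩
          (x +ᴹ u) +ᴹ (-ᴹ y +ᴹ -ᴹ v)  ≈⟨ +ᴹ-congˡ (⁻¹-∙-comm y v) ⟩
          (x +ᴹ u) +ᴹ -ᴹ (y +ᴹ v)     ∎

      ∼-*-cong : ∀ {a b x y} → a ≋ b → x ∼ y → (a *ₗ x) ∼ (b *ₗ y)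
      ∼-*-cong {a} {b} {x} {y} a≋b x∼y =
        ∼-trans (B.respects eq (B.*-closed a x∼y)) (≈⇒∼ (*ₗ-congʳ a≋b))
        where
        *ₗ-neg : a *ₗ (-ᴹ y) ≈ᴹ -ᴹ (a *ₗ y)
        *ₗ-neg = begin
          a *ₗ (-ᴹ y)            ≈⟨ *ₗ-congˡ (Negation.-1*x≈-x M y) ⟨
          a *ₗ ((- 1#) *ₗ y)     ≈⟨ *ₗ-comm a (- 1#) y ⟩
          (- 1#) *ₗ (a *ₗ y)     ≈⟨ Negation.-1*x≈-x M (a *ₗ y) ⟩
          -ᴹ (a *ₗ y)            ∎
        eq : a *ₗ (x +ᴹ -ᴹ y) ≈ᴹ a *ₗ x +ᴹ -ᴹ (a *ₗ y)
        eq = begin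
          a *ₗ (x +ᴹ -ᴹ y)        ≈⟨ *ₗ-distribˡ a x (-ᴹ y) ⟩
          a *ₗ x +ᴹ a *ₗ (-ᴹ y)   ≈⟨ +ᴹ-congˡ *ₗ-neg ⟩
          a *ₗ x +ᴹ -ᴹ (a *ₗ y)   ∎

      ∼-neg-cong : ∀ {x y} → x ∼ y → (-ᴹ x) ∼ (-ᴹ y)
      ∼-neg-cong {x} {y} x∼y = B.respects (≈ᴹ-sym (⁻¹-∙-comm x (-ᴹ y))) (-‿closed B x∼y)

  module _ {m n p q : Level} {M : Module R m p} {N : Module R n q} (f : LinearMap M N) where
    private
      module M = Module M
      module N = Module N
    open LinearMap f

    kernel : Submodule M q
    kernel = record
      { Member   = λ x → ⟦ x ⟧ N.≈ᴹ N.0ᴹ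
      ; respects = λ x≈y fx≈0 → N.≈ᴹ-trans (⟦⟧-cong (M.≈ᴹ-sym x≈y)) fx≈0
      ; 0-closed = 0ᴹ-homo
      ; +-closed = λ {x} {y} fx≈0 fy≈0 → begin
          ⟦ x M.+ᴹ y ⟧      ≈⟨ +ᴹ-homo x y ⟩
          ⟦ x ⟧ N.+ᴹ ⟦ y ⟧  ≈⟨ N.+ᴹ-cong fx≈0 fy≈0 ⟩
          N.0ᴹ N.+ᴹ N.0ᴹ    ≈⟨ N.+ᴹ-identityˡ N.0ᴹ ⟩
          N.0ᴹ              ∎
      ; *-closed = λ a {x} fx≈0 → begin
          ⟦ a M.*ₗ x ⟧  ≈⟨ *ₗ-homo a x ⟩
          a N.*ₗ ⟦ x ⟧  ≈⟨ N.*ₗ-congˡ fx≈0 ⟩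
          a N.*ₗ N.0ᴹ   ≈⟨ N.*ₗ-zeroʳ a ⟩
          N.0ᴹ          ∎
      }
      where open SetoidReasoning N.≈ᴹ-setoid

    image : {t : Level} → Submodule M t → Submodule N (m ⊔ q ⊔ t)
    image S = record
      { Member   = λ y → ∃ λ x → S.Member x × ⟦ x ⟧ N.≈ᴹ y
      ; respects = λ y≈z (x , x∈S , fx≈y) → x , x∈S , N.≈ᴹ-trans fx≈y y≈z
      ; 0-closed = M.0ᴹ , S.0-closed , 0ᴹ-homo
      ; +-closed = λ (x , x∈S , fx≈y) (u , u∈S , fu≈v) →
          x M.+ᴹ u , S.+-closed x∈S u∈S , N.≈ᴹ-trans (+ᴹ-homo x u) (N.+ᴹ-cong fx≈y fu≈v)
      ; *-closed = λ a (x , x∈S , fx≈y) →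
          a M.*ₗ x , S.*-closed a x∈S , N.≈ᴹ-trans (*ₗ-homo a x) (N.*ₗ-congˡ fx≈y)
      }
      where module S = Submodule S

  -- The free module on a setoid: module terms over its elements, modulo the
  -- congruence generated by the module axioms.
  module _ {b e : Level} (B : Setoid b e) where
    private module B = Setoid B

    infixl 6 _+ᶠ_
    infixr 7 _*ᶠ_
    infix  4 _≈ᶠ_

    data FreeTerm : Set (r ⊔ b) where
      gen  : B.Carrier → FreeTerm
      0ᶠ   : FreeTerm
      _+ᶠ_ : FreeTerm → FreeTerm → FreeTerm
      _*ᶠ_ : A → FreeTerm → FreeTerm

    data _≈ᶠ_ : FreeTerm → FreeTerm → Set (r ⊔ s ⊔ b ⊔ e) where
      gen-cong    : ∀ {x y} → x B.≈ y → gen x ≈ᶠ gen y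
      ≈-refl      : ∀ {x} → x ≈ᶠ x
      ≈-sym       : ∀ {x y} → x ≈ᶠ y → y ≈ᶠ x
      ≈-trans     : ∀ {x y z} → x ≈ᶠ y → y ≈ᶠ z → x ≈ᶠ z
      +-cong      : ∀ {x y u v} → x ≈ᶠ y → u ≈ᶠ v → x +ᶠ u ≈ᶠ y +ᶠ v
      +-assoc     : ∀ x y z → (x +ᶠ y) +ᶠ z ≈ᶠ x +ᶠ (y +ᶠ z)
      +-comm      : ∀ x y → x +ᶠ y ≈ᶠ y +ᶠ x
      +-identityˡ : ∀ x → 0ᶠ +ᶠ x ≈ᶠ x
      *-cong      : ∀ {c d x y} → c ≋ d → x ≈ᶠ y → c *ᶠ x ≈ᶠ d *ᶠ y
      *-zeroˡ     : ∀ x → 0# *ᶠ x ≈ᶠ 0ᶠ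
      *-zeroʳ     : ∀ c → c *ᶠ 0ᶠ ≈ᶠ 0ᶠ
      *-distribʳ  : ∀ x c d → (c ⊕ d) *ᶠ x ≈ᶠ c *ᶠ x +ᶠ d *ᶠ x
      *-distribˡ  : ∀ c x y → c *ᶠ (x +ᶠ y) ≈ᶠ c *ᶠ x +ᶠ c *ᶠ y
      *-identityˡ : ∀ x → 1# *ᶠ x ≈ᶠ x
      *-assoc     : ∀ c d x → (c ⊗ d) *ᶠ x ≈ᶠ c *ᶠ (d *ᶠ x)

    private
      inverseˡ : ∀ x → (- 1#) *ᶠ x +ᶠ x ≈ᶠ 0ᶠ
      inverseˡ x =
        ≈-trans (+-cong ≈-refl (≈-sym (*-identityˡ x)))
        (≈-trans (≈-sym (*-distribʳ x (- 1#) 1#))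
        (≈-trans (*-cong (-‿inverseˡ 1#) ≈-refl) (*-zeroˡ x)))

    Free : Module R (r ⊔ b) (r ⊔ s ⊔ b ⊔ e)
    Free = record
      { Carrierᴹ = FreeTerm
      ; _≈ᴹ_     = _≈ᶠ_
      ; _+ᴹ_     = _+ᶠ_
      ; _*ₗ_     = _*ᶠ_
      ; _*ᵣ_     = flip _*ᶠ_
      ; 0ᴹ       = 0ᶠ
      ; -ᴹ_      = (- 1#) *ᶠ_
      ; isModule = IsModuleFromLeft.isModule {commutativeRing = R} record
        { isLeftModule = record
          { isLeftSemimodule = record
            { +ᴹ-isCommutativeMonoid = record
              { isMonoid = record
                { isSemigroup = record
                  { isMagma = record
                    { isEquivalence = record { refl = ≈-refl ; sym = ≈-sym ; trans = ≈-trans }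
                    ; ∙-cong        = +-cong
                    }
                  ; assoc = +-assoc
                  }
                ; identity = +-identityˡ , λ x → ≈-trans (+-comm x 0ᶠ) (+-identityˡ x)
                }
              ; comm = +-comm
              }
            ; isPreleftSemimodule = record
              { *ₗ-cong      = *-cong
              ; *ₗ-zeroˡ     = *-zeroˡ
              ; *ₗ-distribʳ  = *-distribʳ
              ; *ₗ-identityˡ = *-identityˡ
              ; *ₗ-assoc     = *-assoc
              ; *ₗ-zeroʳ     = *-zeroʳ
              ; *ₗ-distribˡ  = *-distribˡ
              }
            }
          ; -ᴹ‿cong    = *-cong ≋-refl
          ; -ᴹ‿inverse = inverseˡ , λ x → ≈-trans (+-comm x _) (inverseˡ x)
          }
        }
      }

    module _ {n q : Level} (N : Module R n q) (f : B.Carrier → Module.Carrierᴹ N)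
             (f-cong : ∀ {x y} → x B.≈ y → Module._≈ᴹ_ N (f x) (f y)) where
      private
        module N = Module N

        extend : FreeTerm → N.Carrierᴹ
        extend (gen x)  = f x
        extend 0ᶠ       = N.0ᴹ
        extend (x +ᶠ y) = extend x N.+ᴹ extend y
        extend (c *ᶠ x) = c N.*ₗ extend x

        extend-cong : ∀ {x y} → x ≈ᶠ y → extend x N.≈ᴹ extend y
        extend-cong (gen-cong x≈y)     = f-cong x≈y
        extend-cong ≈-refl             = N.≈ᴹ-refl
        extend-cong (≈-sym x≈y)        = N.≈ᴹ-sym (extend-cong x≈y)
        extend-cong (≈-trans x≈y y≈z)  = N.≈ᴹ-trans (extend-cong x≈y) (extend-cong y≈z)
        extend-cong (+-cong x≈y u≈v)   = N.+ᴹ-cong (extend-cong x≈y) (extend-cong u≈v)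
        extend-cong (+-assoc x y z)    = N.+ᴹ-assoc _ _ _
        extend-cong (+-comm x y)       = N.+ᴹ-comm _ _
        extend-cong (+-identityˡ x)    = N.+ᴹ-identityˡ _
        extend-cong (*-cong c≈d x≈y)   = N.*ₗ-cong c≈d (extend-cong x≈y)
        extend-cong (*-zeroˡ x)        = N.*ₗ-zeroˡ _
        extend-cong (*-zeroʳ c)        = N.*ₗ-zeroʳ c
        extend-cong (*-distribʳ x c d) = N.*ₗ-distribʳ _ c d
        extend-cong (*-distribˡ c x y) = N.*ₗ-distribˡ c _ _
        extend-cong (*-identityˡ x)    = N.*ₗ-identityˡ _
        extend-cong (*-assoc c d x)    = N.*ₗ-assoc c d _

      linearExtension : LinearMap Free N
      linearExtension = record
        { ⟦_⟧ = extend
        ; isModuleHomomorphism = record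
          { isBimoduleHomomorphism = record
            { +ᴹ-isGroupHomomorphism = record
              { isMonoidHomomorphism = record
                { isMagmaHomomorphism = record
                  { isRelHomomorphism = record { cong = extend-cong }
                  ; homo = λ _ _ → N.≈ᴹ-refl
                  }
                ; ε-homo = N.≈ᴹ-refl
                }
              ; ⁻¹-homo = λ x → Negation.-1*x≈-x N (extend x)
              }
            ; *ₗ-homo = λ _ _ → N.≈ᴹ-refl
            ; *ᵣ-homo = λ c x → N.*ₗ-*ᵣ-coincident c (extend x)
            }
          }
        }

-- Finiteness and decidable edges make "has length ℓ" decidable, which the
-- differential branches on.
record Digraph : Set₁ where
  field
    order : ℕ
    Edge  : Rel (Fin order) 0ℓ
    edge? : Decidable Edge

  Vertex : Set
  Vertex = Fin order

-- The positions 1, …, k of a tuple (x₀, …, xₖ₊₁).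
interior : ∀ {k} → Fin k → Fin (suc (suc k))
interior i = suc (inject₁ i)

module _ (G : Digraph) where
  open Digraph G

  data Path : Vertex → Vertex → ℕ → Set where
    []  : ∀ {x} → Path x x 0
    _∷_ : ∀ {x y z p} → Edge x y → Path y z p → Path x z (suc p)

  -- d(x , y) = d, a natural number; no such d exists when d(x , y) = ∞.
  IsDistance : Vertex → Vertex → ℕ → Set
  IsDistance x y d = Path x y d × (∀ {p} → Path x y p → d ≤ p)

  -- len xs = ℓ, all consecutive distances being finite.
  data HasLength : ∀ {k} → Vec Vertex (suc k) → ℕ → Set where
    [-] : ∀ {x} → HasLength (x ∷ []) 0
    _∷_ : ∀ {k x y d ℓ} {xs : Vec Vertex k} →
          IsDistance x y d → HasLength (y ∷ xs) ℓ → HasLength (x ∷ y ∷ xs) (d + ℓ)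

  path? : ∀ x y p → Dec (Path x y p)
  path? x y zero    = map′ (λ { refl → [] }) (λ { [] → refl }) (x Fin.≟ y)
  path? x y (suc p) = map′ (λ (_ , e , es) → e ∷ es) (λ { (e ∷ es) → _ , e , es })
                           (Fin.any? λ z → edge? x z ×-dec path? z y p)

  isDistance? : ∀ x y d → Dec (IsDistance x y d)
  isDistance? x y d = map′
    (λ (path , shortest) → path , λ q → ℕ.≮⇒≥ (λ p<d → shortest p<d q))
    (λ (path , shortest) → path , λ {p} p<d q → ℕ.<⇒≱ {p} p<d (shortest q))
    (path? x y d ×-dec ℕ.allUpTo? {P = λ p → ¬ Path x y p} (λ p → ¬? (path? x y p)) d)

  hasLength? : ∀ {k} (xs : Vec Vertex (suc k)) ℓ → Dec (HasLength xs ℓ)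
  hasLength? (x ∷ []) zero       = yes [-]
  hasLength? (x ∷ []) (suc ℓ)    = no λ ()
  hasLength? (x ∷ y ∷ xs) ℓ      = map′ to from
    (ℕ.anyUpTo? (λ d → isDistance? x y d ×-dec hasLength? (y ∷ xs) (ℓ ∸ d)) (suc ℓ))
    where
    to : (∃ λ d → d < suc ℓ × IsDistance x y d × HasLength (y ∷ xs) (ℓ ∸ d)) →
         HasLength (x ∷ y ∷ xs) ℓ
    to (d , d≤ℓ , dist , len) =
      subst (HasLength (x ∷ y ∷ xs)) (ℕ.m+[n∸m]≡n (ℕ.≤-pred d≤ℓ)) (dist ∷ len)

    from : HasLength (x ∷ y ∷ xs) ℓ →
           ∃ λ d → d < suc ℓ × IsDistance x y d × HasLength (y ∷ xs) (ℓ ∸ d)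
    from (_∷_ {d = d} {ℓ = ℓ′} dist len) =
      d , s≤s (ℕ.m≤m+n d ℓ′) , dist ,
      subst (HasLength (y ∷ xs)) (sym (ℕ.m+n∸m≡n d ℓ′)) len

  distance-unique : ∀ {x y d d′} → IsDistance x y d → IsDistance x y d′ → d ≡ d′
  distance-unique (p , p-min) (q , q-min) = ℕ.≤-antisym (p-min q) (q-min p)

  length-unique : ∀ {k ℓ ℓ′} {xs : Vec Vertex (suc k)} →
                  HasLength xs ℓ → HasLength xs ℓ′ → ℓ ≡ ℓ′
  length-unique [-]        [-]          = refl
  length-unique (δ ∷ len) (δ′ ∷ len′) = cong₂ _+_ (distance-unique δ δ′) (length-unique len len′)

  distance-refl : ∀ {x} → IsDistance x x 0
  distance-refl = [] , λ _ → z≤n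

  distance-0⇒≡ : ∀ {x y} → IsDistance x y 0 → x ≡ y
  distance-0⇒≡ ([] , _) = refl

  uncons : ∀ {k x y ℓ} {xs : Vec Vertex k} → HasLength (x ∷ y ∷ xs) ℓ →
           ∃ λ d → ∃ λ m → ℓ ≡ d + m × IsDistance x y d × HasLength (y ∷ xs) m
  uncons (δ ∷ len) = _ , _ , refl , δ , len

  -- Deleting y from x, y, x lowers the length, so an interior deletion that keeps
  -- the length leaves consecutive entries distinct.
  removeAt-distinct : ∀ {k ℓ} {xs : Vec Vertex (suc (suc k))} (i : Fin k) →
    Linked _≢_ xs → HasLength xs ℓ → HasLength (removeAt xs (interior i)) ℓ →
    Linked _≢_ (removeAt xs (interior i))
  removeAt-distinct {xs = x ∷ y ∷ z ∷ xs} zero (x≢y ∷ _ ∷ rest)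
    (_∷_ {d = d} δ (_∷_ {d = e} {ℓ = m} _ len)) short = x≢z ∷ rest
    where
    x≢z : x ≢ z
    x≢z refl with uncons short
    ... | f , m′ , eq , ζ , len′ = x≢y (distance-0⇒≡ (subst (IsDistance x y) d≡0 δ))
      where
      d+e+m≡m : (d + e) + m ≡ m
      d+e+m≡m = trans (ℕ.+-assoc d e m)
        (trans eq (cong₂ _+_ (distance-unique ζ distance-refl) (length-unique len′ len)))

      d≡0 : d ≡ 0
      d≡0 = ℕ.m+n≡0⇒m≡0 d (ℕ.+-cancelʳ-≡ m (d + e) 0 d+e+m≡m)
  removeAt-distinct {xs = x ∷ y ∷ z ∷ xs} (suc i) (x≢y ∷ rest) (_∷_ {d = d} {ℓ = ℓ} δ len) short
    with uncons short
  ... | f , m , eq , ζ , len′ = x≢y ∷ removeAt-distinct i rest len (subst (HasLength _) m≡ℓ len′)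
    where
    m≡ℓ : m ≡ ℓ
    m≡ℓ = sym (ℕ.+-cancelˡ-≡ d ℓ m (trans eq (cong (_+ m) (distance-unique ζ δ))))

T : ℕ → Digraph
T n = record { order = suc n ; Edge = Fin._<_ ; edge? = Fin._<?_ }

module _ {r s : Level} (R : CommutativeRing r s) (G : Digraph) where
  open CommutativeRing R using (-_; 1#; semiring)
  open Digraph G
  open SemiringExp semiring using (_^_)

  -- Finiteness of the consecutive distances is part of HasLength.
  record Tuple (k ℓ : ℕ) : Set where
    field
      vertices  : Vec Vertex (suc k)
      distinct  : Linked _≢_ vertices
      hasLength : HasLength G vertices ℓ
  open Tuple

  tupleSetoid : ℕ → ℕ → Setoid 0ℓ 0ℓ
  tupleSetoid k ℓ = record
    { Carrier       = Tuple k ℓ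
    ; _≈_           = λ x y → vertices x ≡ vertices y
    ; isEquivalence = record { refl = refl ; sym = sym ; trans = trans }
    }

  MC : ℕ → ℕ → Module R r (r ⊔ s)
  MC k ℓ = Free R (tupleSetoid k ℓ)

  module _ {k ℓ : ℕ} where
    open Module (MC k ℓ)
    open MonoidSum +ᴹ-monoid using (sum; sum-cong-≋)

    face : Fin k → Tuple (suc k) ℓ → Carrierᴹ
    face i x with hasLength? G (removeAt (vertices x) (interior i)) ℓ
    ... | yes len = gen record
      { vertices  = removeAt (vertices x) (interior i)
      ; distinct  = removeAt-distinct G i (distinct x) (hasLength x) len
      ; hasLength = len
      }
    ... | no _    = 0ᴹ

    boundary : Tuple (suc k) ℓ → Carrierᴹ
    boundary x = sum λ i → ((- 1#) ^ toℕ (interior i)) *ₗ face i x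

    face-cong : ∀ i {x y} → vertices x ≡ vertices y → face i x ≈ᴹ face i y
    face-cong i {x} {record { vertices = _ }} refl
      with hasLength? G (removeAt (vertices x) (interior i)) ℓ
    ... | yes _ = gen-cong refl
    ... | no _  = ≈ᴹ-refl

    boundary-cong : ∀ {x y} → vertices x ≡ vertices y → boundary x ≈ᴹ boundary y
    boundary-cong {x} {y} x≡y =
      sum-cong-≋ (λ i → *ₗ-congˡ {(- 1#) ^ toℕ (interior i)} (face-cong i {x} {y} x≡y))

  ∂ : ∀ k ℓ → LinearMap R (MC (suc k) ℓ) (MC k ℓ)
  ∂ k ℓ = linearExtension R (tupleSetoid (suc k) ℓ) (MC k ℓ) boundary
            λ {x} {y} → boundary-cong {x = x} {y}

  EMC : ∀ k ℓ → Submodule R (MC k ℓ) (r ⊔ s)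
  EMC k ℓ = span R λ t → ∃ λ x → Unique (vertices x) × t ≡ gen x

  -- In degree 0 the differential is 0.
  cycles : ∀ k ℓ → Submodule R (MC k ℓ) (r ⊔ s)
  cycles zero    ℓ = whole R
  cycles (suc k) ℓ = kernel R (∂ k ℓ)

  MH : ℕ → ℕ → Module R (r ⊔ s) (r ⊔ s)
  MH k ℓ = subquotient R (cycles k ℓ) (image R (∂ k ℓ) (whole R {q = 0ℓ}))

  EMH : ℕ → ℕ → Module R (r ⊔ s) (r ⊔ s)
  EMH k ℓ = subquotient R (_∩_ R (EMC k ℓ) (cycles k ℓ)) (image R (∂ k ℓ) (EMC (suc k) ℓ))

  Diagonal : Set (r ⊔ s)
  Diagonal = ∀ k ℓ → k ≢ ℓ → IsZero R (MH k ℓ)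

  RegularlyDiagonal : Set (r ⊔ s)
  RegularlyDiagonal = ∀ k ℓ → k ≢ ℓ → IsZero R (EMH k ℓ)

{-# OPTIONS --safe #-}
-- In a digraph with transitive edge relation, distinct vertices at finite
-- distance are at distance 1, so a tuple (x₀, …, xₖ) has length k. Off the
-- diagonal the magnitude chain modules are therefore already zero.
module Submission where

open import Defs
open import Algebra.Bundles using (CommutativeRing)
open import Algebra.Module.Bundles using (Module)
import Data.Fin.Properties as Fin
open import Data.Nat using (ℕ; suc; _+_; s≤s; z≤n)
import Data.Nat.Properties as ℕ
open import Data.Product using (_×_; _,_)
open import Data.Vec using (Vec)
open import Data.Vec.Relation.Unary.Linked using (Linked; _∷_)
open import Level using (Level; 0ℓ)
open import Relation.Binary using (Setoid; Transitive)
open import Relation.Binary.PropositionalEquality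
  using (_≡_; _≢_; refl; sym; cong₂)
open import Relation.Nullary using (¬_; contradiction)

module _ {r s : Level} (R : CommutativeRing r s) where

  -- Equality in the subquotient means that the difference lies in `B`; every difference is zero in
  -- `M`, and `B` contains `0ᴹ`.
  subquotient-isZero : {m p q₁ q₂ : Level} {M : Module R m p}
    (Z : Submodule R M q₁) (B : Submodule R M q₂) →
    IsZero R M → IsZero R (subquotient R Z B)
  subquotient-isZero {M = M} Z B M≈0 (x , _) = B.respects (≈ᴹ-sym (M≈0 _)) B.0-closed
    where
    open Module M using (≈ᴹ-sym)
    module B = Submodule B

  -- Without generators there are still formal terms such as `0ᶠ +ᶠ 0ᶠ`; induction on terms
  -- collapses them.
  Free-isZero : {b e : Level} (B : Setoid b e) →
    ¬ Setoid.Carrier B → IsZero R (Free R B)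
  Free-isZero B empty (gen x)  = contradiction x empty
  Free-isZero B empty 0ᶠ       = ≈-refl
  Free-isZero B empty (x +ᶠ y) =
    ≈-trans (+-cong (Free-isZero B empty x) (Free-isZero B empty y)) (+-identityˡ 0ᶠ)
  Free-isZero B empty (c *ᶠ x) =
    ≈-trans (*-cong (CommutativeRing.refl R) (Free-isZero B empty x)) (*-zeroʳ c)

module _ (G : Digraph) (Edge-trans : Transitive (Digraph.Edge G)) where
  open Digraph G

  path⇒edge : ∀ {x y p} → Path G x y (suc p) → Edge x y
  path⇒edge (e ∷ [])         = e
  -- Matching on the tail shows that it is nonempty, as the recursive call requires.
  path⇒edge (e ∷ es@(_ ∷ _)) = Edge-trans e (path⇒edge es)

  -- Since `x ≢ y`, the shortest path is nonempty, so `1 ≤ d`; transitivity contracts it to a single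
  -- edge, so `d ≤ 1` by minimality.
  distance≡1 : ∀ {x y d} → x ≢ y → IsDistance G x y d → d ≡ 1
  distance≡1 x≢y ([] , _)               = contradiction refl x≢y
  distance≡1 x≢y (es@(_ ∷ _) , minimal) =
    ℕ.≤-antisym (minimal (path⇒edge es ∷ [])) (s≤s z≤n)

  length≡degree : ∀ {k ℓ} {xs : Vec Vertex (suc k)} →
    Linked _≢_ xs → HasLength G xs ℓ → ℓ ≡ k
  length≡degree _              [-]       = refl
  length≡degree (x≢y ∷ linked) (δ ∷ len) =
    cong₂ _+_ (distance≡1 x≢y δ) (length≡degree linked len)

  module _ {r s : Level} (R : CommutativeRing r s) where

    MC-isZero : ∀ k ℓ → k ≢ ℓ → IsZero R (MC R G k ℓ)
    MC-isZero k ℓ k≢ℓ = Free-isZero R (tupleSetoid R G k ℓ) λ x →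
      k≢ℓ (sym (length≡degree (Tuple.distinct x) (Tuple.hasLength x)))

    diagonal : Diagonal R G
    diagonal k ℓ k≢ℓ = subquotient-isZero R
      (cycles R G k ℓ) (image R (∂ R G k ℓ) (whole R {q = 0ℓ}))
      (MC-isZero k ℓ k≢ℓ)

    -- `EMH` is formed as a subquotient of the ambient `MC`, so the vanishing of `MC` settles this
    -- case too.
    regularlyDiagonal : RegularlyDiagonal R G
    regularlyDiagonal k ℓ k≢ℓ = subquotient-isZero R
      (_∩_ R (EMC R G k ℓ) (cycles R G k ℓ)) (image R (∂ R G k ℓ) (EMC R G (suc k) ℓ))
      (MC-isZero k ℓ k≢ℓ)

corollary3p7 : {r s : Level} (R : CommutativeRing r s) (n : ℕ) →
    Diagonal R (T n) × RegularlyDiagonal R (T n)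
corollary3p7 R n =
  diagonal (T n) Fin.<-trans R , regularlyDiagonal (T n) Fin.<-trans R
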